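{- For every integer $n\ge 1$, there exists an involution $\phi$ on $S_n$ such that for every $\pi\in S_n$, $$\mathrm{rlm}(\pi)=\mathrm{lrmax}(\phi(\pi))-1\quad\text{and}\quad \mathrm{lrmax}(\pi)-1=\mathrm{rlm}(\phi(\pi)).$$
   Context: $S_n$ is the set of permutations $\pi=\pi_1\pi_2\cdots\pi_n$ of $[n]=\{1,\dots,n\}$. For a word $w=w_1\cdots w_m$ of distinct integers, $w_i$ is an RL-maximum if $w_i>w_j$ for all $j>i$, and an LR-maximum if $w_i>w_j$ for all $j<i$; $\mathrm{lrmax}(w)$ is the number of LR-maxima of $w$. For $\pi\in S_n$, $\mathrm{rlm}(\pi)$ is the number of RL-maxima of the (possibly empty) subword of $\pi$ consisting of the letters to the left of the letter $1$. An involution on $S_n$ is a map $\phi:S_n\to S_n$ with $\phi\circ\phi=\mathrm{id}$. -}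

module Defs where

open import Data.Fin.Base as Fin using (Fin; toℕ)
import Data.Fin.Properties as Fin
open import Data.Fin.Permutation using (Permutation′; _⟨$⟩ʳ_)
open import Data.List.Base
  using (List; length; lookup; filter; takeWhile; tabulate; allFin)
open import Data.Nat.Base using (ℕ; suc; _>_)
open import Data.Nat.Properties using (_≟_; _>?_)
open import Relation.Nullary.Decidable using (¬?; _→-dec_)
open import Relation.Unary using (Decidable)

Word : Set
Word = List ℕ

IsRLMax : (w : Word) → Fin (length w) → Set
IsRLMax w i = ∀ j → j Fin.> i → lookup w i > lookup w j

IsLRMax : (w : Word) → Fin (length w) → Set
IsLRMax w i = ∀ j → j Fin.< i → lookup w i > lookup w j

isRLMax? : ∀ w → Decidable (IsRLMax w)
isRLMax? w i = Fin.all? λ j → (i Fin.<? j) →-dec (lookup w i >? lookup w j)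

isLRMax? : ∀ w → Decidable (IsLRMax w)
isLRMax? w i = Fin.all? λ j → (j Fin.<? i) →-dec (lookup w i >? lookup w j)

-- Positions are counted rather than letters; the two counts agree for
-- words with distinct letters, the only ones used.
rlmax : Word → ℕ
rlmax w = length (filter (isRLMax? w) (allFin (length w)))

lrmax : Word → ℕ
lrmax w = length (filter (isLRMax? w) (allFin (length w)))

-- One-line notation π₁π₂⋯πₙ. A permutation acts on Fin n = {0,…,n-1}, so
-- its values are shifted by one to give letters in {1,…,n}.
word : ∀ {n} → Permutation′ n → Word
word π = tabulate λ i → suc (toℕ (π ⟨$⟩ʳ i))

leftOf1 : Word → Word
leftOf1 = takeWhile λ a → ¬? (a ≟ 1)

rlm : ∀ {n} → Permutation′ n → ℕ
rlm π = rlmax (leftOf1 (word π))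

{-# OPTIONS --safe #-}
-- Erase the letter 2 from a permutation of [n+1], n ≥ 1. Conversely, of the
-- n+1 places where 2 can be put back into π ∈ Sₙ, exactly one (just before 1)
-- raises rlm, by one, and exactly one raises lrmax, by one: the front, or, when
-- π starts with 1, the place right after that 1. These two places differ, and
-- nothing else changes. So φ is obtained recursively by exchanging them.
module Submission where

open import Defs
open import Algebra.Definitions using (Involutive)
open import Data.Fin.Permutation using (Permutation′; _≈_)
open import Data.Nat.Base using (ℕ; _≥_; _∸_)
open import Data.Product.Base using (Σ-syntax; _×_)
open import Function.Definitions using (Congruent)
open import Relation.Binary.PropositionalEquality.Core using (_≡_)

open import Data.Bool.Base using (if_then_else_; true; false)
open import Data.Fin.Base as Fin using (Fin; zero; suc; toℕ; inject₁; punchIn; cast)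
open import Data.Fin.Patterns using (0F; 1F)
import Data.Fin.Properties as Fin
open import Data.Fin.Permutation
  using (Permutation; _⟨$⟩ʳ_; _⟨$⟩ˡ_; inverseˡ; inverseʳ; insert; remove; id;
         insert-punchIn; insert-remove; remove-insert; punchIn-permute)
open import Data.List.Base
  using (_∷_; length; lookup; filter; tabulate)
open import Data.List.Properties
  using (length-tabulate; lookup-tabulate; tabulate-cong)
open import Data.Nat.Base
  using (zero; suc; 2+; _+_; _≤_; _<_; z≤n; s≤s; z<s; s<s; s<s⁻¹)
open import Data.Nat.Properties as ℕ using (+-0-commutativeMonoid)
open import Algebra.Properties.CommutativeMonoid.Sum +-0-commutativeMonoid
  using (sum; sum-cong-≗; sum-remove)
open import Data.Product.Base using (_,_; proj₂)
open import Function.Base using (_∘_)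
open import Function.Bundles using (_⇔_; mk⇔; module Equivalence)
open import Relation.Binary.PropositionalEquality
  using (_≢_; refl; sym; trans; cong; cong₂; subst; subst₂; module ≡-Reasoning)
open import Relation.Nullary.Decidable
  using (Dec; yes; no; does; does-⇔; dec-true; dec-false; _×-dec_; _→-dec_)
open import Relation.Nullary.Negation using (¬_; contradiction)
open import Relation.Unary using (Decidable)

open Equivalence using (to; from)
open ≡-Reasoning

private
  variable
    m n : ℕ
    A B : Set

-- Counting positions by sums of indicators.

𝟙 : Dec A → ℕ
𝟙 d = if does d then 1 else 0

𝟙-cong : A ⇔ B → (a? : Dec A) (b? : Dec B) → 𝟙 a? ≡ 𝟙 b?
𝟙-cong A⇔B a? b? = cong (if_then 1 else 0) (does-⇔ A⇔B a? b?)

𝟙-true : (a? : Dec A) → A → 𝟙 a? ≡ 1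
𝟙-true a? a = cong (if_then 1 else 0) (dec-true a? a)

𝟙-false : (a? : Dec A) → ¬ A → 𝟙 a? ≡ 0
𝟙-false a? ¬a = cong (if_then 1 else 0) (dec-false a? ¬a)

-- A sum rather than the length of a filtered list, because a sum can be split at an arbitrary
-- index, here the position of the inserted letter.
count : {P : Fin n → Set} → Decidable P → ℕ
count P? = sum (λ i → 𝟙 (P? i))

count-cong : {P Q : Fin n → Set} (P? : Decidable P) (Q? : Decidable Q) →
             (∀ i → P i ⇔ Q i) → count P? ≡ count Q?
count-cong P? Q? P⇔Q = sum-cong-≗ (λ i → 𝟙-cong (P⇔Q i) (P? i) (Q? i))

count-none : {P : Fin n → Set} (P? : Decidable P) → (∀ i → ¬ P i) → count P? ≡ 0
count-none {zero}  P? ¬P = refl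
count-none {suc n} P? ¬P =
  cong₂ _+_ (𝟙-false (P? 0F) (¬P 0F)) (count-none (P? ∘ suc) (¬P ∘ suc))

-- `allFin` is `tabulate` of the identity, but `f` has to be arbitrary for the induction: the tail
-- of `tabulate f` is `tabulate (f ∘ suc)`.
length-filter-tabulate : {A : Set} {P : A → Set} (P? : Decidable P) (f : Fin n → A) →
                         length (filter P? (tabulate f)) ≡ count (P? ∘ f)
length-filter-tabulate {zero}  P? f = refl
length-filter-tabulate {suc n} P? f with does (P? (f 0F))
... | true  = cong suc (length-filter-tabulate P? (f ∘ suc))
... | false = length-filter-tabulate P? (f ∘ suc)

-- Both statistics as counts over the positions of a function.

LRMax : (Fin n → Fin m) → Fin n → Set
LRMax f i = ∀ j → j Fin.< i → f j Fin.< f i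

LRMax? : (f : Fin n → Fin m) → Decidable (LRMax f)
LRMax? f i = Fin.all? λ j → (j Fin.<? i) →-dec (f j Fin.<? f i)

-- Here `q` stands for the position of the letter 1. Bounding positions by `q` replaces truncating
-- the word, so all positions stay in `Fin n`.
RLMaxBefore : Fin n → (Fin n → Fin m) → Fin n → Set
RLMaxBefore q f i = i Fin.< q × (∀ j → i Fin.< j → j Fin.< q → f j Fin.< f i)

RLMaxBefore? : (q : Fin n) (f : Fin n → Fin m) → Decidable (RLMaxBefore q f)
RLMaxBefore? q f i =
  (i Fin.<? q) ×-dec
  Fin.all? λ j → (i Fin.<? j) →-dec (j Fin.<? q) →-dec (f j Fin.<? f i)

letters : (Fin n → Fin m) → Word
letters f = tabulate (λ i → suc (toℕ (f i)))

-- The word is kept general so that matching on length w ≡ n is possible.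
lrmax-count : ∀ w (f : Fin n → Fin m) (eq : length w ≡ n) →
              (∀ i → lookup w (cast (sym eq) i) ≡ suc (toℕ (f i))) →
              lrmax w ≡ count (LRMax? f)
lrmax-count w f refl w≗f =
  trans (length-filter-tabulate (isLRMax? w) (λ i → i))
        (count-cong (isLRMax? w) (LRMax? f) λ i → mk⇔
          (λ max j j<i → s<s⁻¹ (subst₂ _<_ (at j) (at i) (max j j<i)))
          (λ max j j<i → subst₂ _<_ (sym (at j)) (sym (at i)) (s<s (max j j<i))))
  where
  at : ∀ i → lookup w i ≡ suc (toℕ (f i))
  at i = trans (cong (lookup w) (sym (Fin.cast-is-id refl i))) (w≗f i)

lrmax-letters : (f : Fin n → Fin m) → lrmax (letters f) ≡ count (LRMax? f)
lrmax-letters f = lrmax-count (letters f) f (length-tabulate _) (lookup-tabulate _)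

rlmax-count : ∀ w → rlmax w ≡ count (isRLMax? w)
rlmax-count w = length-filter-tabulate (isRLMax? w) (λ i → i)

-- RL-maximality looks only to the right, so a letter put in front does not affect the later
-- positions.
rlmax-∷ : ∀ a w → rlmax (a ∷ w) ≡ 𝟙 (isRLMax? (a ∷ w) 0F) + rlmax w
rlmax-∷ a w = begin
  rlmax (a ∷ w)
    ≡⟨ rlmax-count (a ∷ w) ⟩
  𝟙 (isRLMax? (a ∷ w) 0F) + count (isRLMax? (a ∷ w) ∘ suc)
    ≡⟨ cong (𝟙 (isRLMax? (a ∷ w) 0F) +_)
         (count-cong (isRLMax? (a ∷ w) ∘ suc) (isRLMax? w) λ i → mk⇔
           (λ max j j>i → max (suc j) (s<s j>i))
           (λ { max (suc j) j>i → max j (s<s⁻¹ j>i) })) ⟩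
  𝟙 (isRLMax? (a ∷ w) 0F) + count (isRLMax? w)
    ≡⟨ cong (𝟙 (isRLMax? (a ∷ w) 0F) +_) (rlmax-count w) ⟨
  𝟙 (isRLMax? (a ∷ w) 0F) + rlmax w ∎

IsFirstZero : (Fin n → Fin (suc m)) → Fin n → Set
IsFirstZero f q = f q ≡ 0F × (∀ j → j Fin.< q → f j ≢ 0F)

IsFirstZero-tail : (f : Fin (suc n) → Fin (suc m)) {q : Fin n} →
                   IsFirstZero f (suc q) → IsFirstZero (f ∘ suc) q
IsFirstZero-tail f (fq≡0 , before) = fq≡0 , λ j j<q → before (suc j) (s<s j<q)

-- Positions of the truncated word lie in `Fin` of a length that does not compute. This moves a
-- quantifier over them to the positions before `q`, by peeling off letters that are not 1.
leftOf1-letters : (P : ℕ → Set) (f : Fin n → Fin (suc m)) (q : Fin n) → IsFirstZero f q →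
                  (∀ k → P (lookup (leftOf1 (letters f)) k)) ⇔
                  (∀ j → j Fin.< q → P (suc (toℕ (f j))))
leftOf1-letters P f zero (f0≡0 , _) with f 0F
leftOf1-letters P f zero (refl , _) | _ = mk⇔ (λ _ _ ()) (λ _ ())
leftOf1-letters P f (suc q) q-first with f 0F in f0≡
... | zero  = contradiction f0≡ (proj₂ q-first 0F z<s)
... | suc v = mk⇔
  (λ { P-left zero _ → subst (P ∘ suc ∘ toℕ) (sym f0≡) (P-left 0F)
     ; P-left (suc j) j<q → to tail (P-left ∘ suc) j (s<s⁻¹ j<q) })
  (λ { P-before zero → subst (P ∘ suc ∘ toℕ) f0≡ (P-before 0F z<s)
     ; P-before (suc k) → from tail (λ j j<q → P-before (suc j) (s<s j<q)) k })
  where tail = leftOf1-letters P (f ∘ suc) q (IsFirstZero-tail f q-first)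

rlmax-leftOf1-letters : (f : Fin n → Fin (suc m)) (q : Fin n) → IsFirstZero f q →
                        rlmax (leftOf1 (letters f)) ≡ count (RLMaxBefore? q f)
rlmax-leftOf1-letters f zero (f0≡0 , _) = trans
  (cong (rlmax ∘ leftOf1) (cong (λ v → suc (toℕ v) ∷ letters (f ∘ suc)) f0≡0))
  (sym (count-none (RLMaxBefore? 0F f) (λ _ → λ ())))
rlmax-leftOf1-letters f (suc q) q-first = begin
  rlmax (leftOf1 (letters f))
    ≡⟨ cong rlmax unfold ⟩
  rlmax (a ∷ w)
    ≡⟨ rlmax-∷ a w ⟩
  𝟙 (isRLMax? (a ∷ w) 0F) + rlmax w
    -- The first letter is an RL-maximum when all letters of `w` are below it; `head` restates this
    -- for the positions before `q`.
    ≡⟨ cong₂ _+_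
         (𝟙-cong (mk⇔
           (λ max → z<s , λ { (suc j) _ j<q → s<s⁻¹ (to head (λ k → max (suc k) z<s) j (s<s⁻¹ j<q)) })
           (λ { (_ , max) (suc k) _ → from head (λ j j<q → s<s (max (suc j) z<s (s<s j<q))) k }))
           (isRLMax? (a ∷ w) 0F) (RLMaxBefore? (suc q) f 0F))
         (rlmax-leftOf1-letters (f ∘ suc) q (IsFirstZero-tail f q-first)) ⟩
  𝟙 (RLMaxBefore? (suc q) f 0F) + count (RLMaxBefore? q (f ∘ suc))
    ≡⟨ cong (𝟙 (RLMaxBefore? (suc q) f 0F) +_)
         (count-cong (RLMaxBefore? q (f ∘ suc)) (RLMaxBefore? (suc q) f ∘ suc) λ i → mk⇔
           (λ { (i<q , max) → s<s i<q ,
                λ { (suc j) i<j j<q → max j (s<s⁻¹ i<j) (s<s⁻¹ j<q) } })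
           (λ { (i<q , max) → s<s⁻¹ i<q ,
                λ j i<j j<q → max (suc j) (s<s i<j) (s<s j<q) })) ⟩
  count (RLMaxBefore? (suc q) f) ∎
  where
  a = suc (toℕ (f 0F))
  w = leftOf1 (letters (f ∘ suc))
  head = leftOf1-letters (_< a) (f ∘ suc) q (IsFirstZero-tail f q-first)

  unfold : leftOf1 (letters f) ≡ a ∷ w
  unfold with f 0F in f0≡
  ... | zero  = contradiction f0≡ (proj₂ q-first 0F z<s)
  ... | suc _ = refl

-- Permutations up to pointwise equality, and insertion of a position.

⟨$⟩ʳ-injective : (π : Permutation m n) {i j : Fin m} → π ⟨$⟩ʳ i ≡ π ⟨$⟩ʳ j → i ≡ j
⟨$⟩ʳ-injective π eq = trans (sym (inverseˡ π)) (trans (cong (π ⟨$⟩ˡ_) eq) (inverseˡ π))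

⟨$⟩ˡ-unique : (π : Permutation m n) {i : Fin m} {j : Fin n} → π ⟨$⟩ʳ i ≡ j → π ⟨$⟩ˡ j ≡ i
⟨$⟩ˡ-unique π eq = trans (cong (π ⟨$⟩ˡ_) (sym eq)) (inverseˡ π)

⟨$⟩ˡ-cong : (π ρ : Permutation m n) → π ≈ ρ → ∀ j → π ⟨$⟩ˡ j ≡ ρ ⟨$⟩ˡ j
⟨$⟩ˡ-cong π ρ π≈ρ j = ⟨$⟩ˡ-unique π (trans (π≈ρ _) (inverseʳ ρ))

-- By injectivity the letter 1 occurs only at `q`, so `q` is its first occurrence.
rlm-count : (π : Permutation′ (suc n)) (q : Fin (suc n)) → π ⟨$⟩ʳ q ≡ 0F →
            rlm π ≡ count (RLMaxBefore? q (π ⟨$⟩ʳ_))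
rlm-count π q πq≡0 = rlmax-leftOf1-letters (π ⟨$⟩ʳ_) q
  (πq≡0 , λ j j<q πj≡0 → Fin.<⇒≢ j<q (⟨$⟩ʳ-injective π (trans πj≡0 (sym πq≡0))))

word-cong : (π ρ : Permutation′ n) → π ≈ ρ → word π ≡ word ρ
word-cong π ρ π≈ρ = tabulate-cong (λ i → cong (suc ∘ toℕ) (π≈ρ i))

punchIn-mono-< : ∀ (i : Fin (suc n)) {j k} → j Fin.< k → punchIn i j Fin.< punchIn i k
punchIn-mono-< i j<k = ℕ.≰⇒> (ℕ.<⇒≱ j<k ∘ Fin.punchIn-cancel-≤ i _ _)

punchIn-cancel-< : ∀ (i : Fin (suc n)) {j k} → punchIn i j Fin.< punchIn i k → j Fin.< k
punchIn-cancel-< i ij<ik = ℕ.≰⇒> (ℕ.<⇒≱ ij<ik ∘ Fin.punchIn-mono-≤ i _ _)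

<punchIn⇒≤ : ∀ (i : Fin (suc n)) j → i Fin.< punchIn i j → i Fin.≤ j
<punchIn⇒≤ zero    j       _   = z≤n
<punchIn⇒≤ (suc i) (suc j) lt = s≤s (<punchIn⇒≤ i j (s<s⁻¹ lt))

toℕ-punchIn-≥ : ∀ (i : Fin (suc n)) j → i Fin.≤ j → toℕ (punchIn i j) ≡ suc (toℕ j)
toℕ-punchIn-≥ zero    j       _         = refl
toℕ-punchIn-≥ (suc i) (suc j) (s≤s i≤j) = cong suc (toℕ-punchIn-≥ i j i≤j)

-- The case split used for every insertion: a position is either the new one or the image of an old
-- one.
punchIn-elim : (P : Fin (suc n) → Set) (i : Fin (suc n)) →
               P i → (∀ j → P (punchIn i j)) → ∀ k → P k
punchIn-elim P i Pi P-punchIn k with i Fin.≟ k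
... | yes refl = Pi
... | no i≢k   = subst P (Fin.punchIn-punchOut i≢k) (P-punchIn _)

insert-at : ∀ i j (π : Permutation m n) → insert i j π ⟨$⟩ʳ i ≡ j
insert-at i j π with i Fin.≟ i
... | yes _  = refl
... | no i≢i = contradiction refl i≢i

insert-cong : ∀ {i i′ j} (π ρ : Permutation m n) → i ≡ i′ → π ≈ ρ →
              insert i j π ≈ insert i′ j ρ
insert-cong {i = i} {j = j} π ρ refl π≈ρ = punchIn-elim _ i
  (trans (insert-at i j π) (sym (insert-at i j ρ)))
  (λ k → trans (insert-punchIn i j π k)
    (trans (cong (punchIn j) (π≈ρ k)) (sym (insert-punchIn i j ρ k))))

remove-cong : ∀ {i i′} (π ρ : Permutation (suc m) (suc n)) → i ≡ i′ → π ≈ ρ →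
              remove i π ≈ remove i′ ρ
remove-cong {i = i} π ρ refl π≈ρ k = Fin.punchIn-injective (π ⟨$⟩ʳ i) _ _ (begin
  punchIn (π ⟨$⟩ʳ i) (remove i π ⟨$⟩ʳ k)  ≡⟨ punchIn-permute π i k ⟨
  π ⟨$⟩ʳ punchIn i k                      ≡⟨ π≈ρ _ ⟩
  ρ ⟨$⟩ʳ punchIn i k                      ≡⟨ punchIn-permute ρ i k ⟩
  punchIn (ρ ⟨$⟩ʳ i) (remove i ρ ⟨$⟩ʳ k)  ≡⟨ cong (λ v → punchIn v (remove i ρ ⟨$⟩ʳ k)) (π≈ρ i) ⟨
  punchIn (π ⟨$⟩ʳ i) (remove i ρ ⟨$⟩ʳ k)  ∎)

-- Coding a permutation by its reduction and the place of 2.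

-- When the letter 1 is at position q, the letter 2 is inserted at position
-- place q c: just before 1 for c = 0, and at the place raising lrmax for c = 1.
place : Fin (suc m) → Permutation′ (2+ m)
place q = insert 0F (inject₁ q) id

position1 : Permutation′ (suc m) → Fin (suc m)
position1 σ = σ ⟨$⟩ˡ 0F

-- The letter 2 is the element 1F.
insert2 : Permutation′ (suc m) → Fin (2+ m) → Permutation′ (2+ m)
insert2 σ c = insert (place (position1 σ) ⟨$⟩ʳ c) 1F σ

delete2 : Permutation′ (2+ m) → Permutation′ (suc m)
delete2 π = remove (π ⟨$⟩ˡ 1F) π

-- The position of 1 is taken after deleting 2, since `place` refers to the shorter word.
code2 : Permutation′ (2+ m) → Fin (2+ m)
code2 π = place (position1 (delete2 π)) ⟨$⟩ˡ (π ⟨$⟩ˡ 1F)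

insert2-cong : ∀ {c d} (σ ρ : Permutation′ (suc m)) → σ ≈ ρ → c ≡ d → insert2 σ c ≈ insert2 ρ d
insert2-cong {c = c} σ ρ σ≈ρ refl =
  insert-cong σ ρ (cong (λ q → place q ⟨$⟩ʳ c) (⟨$⟩ˡ-cong σ ρ σ≈ρ 0F)) σ≈ρ

delete2-cong : (π ρ : Permutation′ (2+ m)) → π ≈ ρ → delete2 π ≈ delete2 ρ
delete2-cong π ρ π≈ρ = remove-cong π ρ (⟨$⟩ˡ-cong π ρ π≈ρ 1F) π≈ρ

code2-cong : (π ρ : Permutation′ (2+ m)) → π ≈ ρ → code2 π ≡ code2 ρ
code2-cong π ρ π≈ρ = cong₂ (λ q p → place q ⟨$⟩ˡ p)
  (⟨$⟩ˡ-cong (delete2 π) (delete2 ρ) (delete2-cong π ρ π≈ρ) 0F)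
  (⟨$⟩ˡ-cong π ρ π≈ρ 1F)

insert2-position : (σ : Permutation′ (suc m)) (c : Fin (2+ m)) →
                   insert2 σ c ⟨$⟩ˡ 1F ≡ place (position1 σ) ⟨$⟩ʳ c
insert2-position σ c = ⟨$⟩ˡ-unique (insert2 σ c) (insert-at (place (position1 σ) ⟨$⟩ʳ c) 1F σ)

delete2-insert2 : (σ : Permutation′ (suc m)) (c : Fin (2+ m)) → delete2 (insert2 σ c) ≈ σ
delete2-insert2 σ c k = trans
  (remove-cong (insert2 σ c) (insert2 σ c) (insert2-position σ c) (λ _ → refl) k)
  (remove-insert (place (position1 σ) ⟨$⟩ʳ c) 1F σ k)

-- Deleting 2 restores `σ`, hence the position of 1, so the same `place` is applied and then
-- inverted.
code2-insert2 : (σ : Permutation′ (suc m)) (c : Fin (2+ m)) → code2 (insert2 σ c) ≡ c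
code2-insert2 σ c = trans
  (cong₂ (λ q p → place q ⟨$⟩ˡ p)
    (⟨$⟩ˡ-cong (delete2 (insert2 σ c)) σ (delete2-insert2 σ c) 0F)
    (insert2-position σ c))
  (inverseˡ (place (position1 σ)))

insert2-delete2 : (π : Permutation′ (2+ m)) → insert2 (delete2 π) (code2 π) ≈ π
insert2-delete2 π k = begin
  insert (place (position1 (delete2 π)) ⟨$⟩ʳ code2 π) 1F (delete2 π) ⟨$⟩ʳ k
    ≡⟨ insert-cong (delete2 π) (delete2 π) (inverseʳ (place (position1 (delete2 π)))) (λ _ → refl) k ⟩
  insert (π ⟨$⟩ˡ 1F) 1F (delete2 π) ⟨$⟩ʳ k
    -- The value `1F` is rewritten as the value of `π` at its own preimage, the form in which
    -- insertion undoes removal.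
    ≡⟨ cong (λ v → insert (π ⟨$⟩ˡ 1F) v (delete2 π) ⟨$⟩ʳ k) (inverseʳ π) ⟨
  insert (π ⟨$⟩ˡ 1F) (π ⟨$⟩ʳ (π ⟨$⟩ˡ 1F)) (delete2 π) ⟨$⟩ʳ k
    ≡⟨ insert-remove (π ⟨$⟩ˡ 1F) π k ⟩
  π ⟨$⟩ʳ k ∎

-- Effect of inserting 2 on the two statistics.

count-remove : {P : Fin (suc n) → Set} (P? : Decidable P) (i : Fin (suc n)) →
               count P? ≡ 𝟙 (P? i) + count (P? ∘ punchIn i)
count-remove P? i = sum-remove {i = i} (λ j → 𝟙 (P? j))

1<punchIn1 : (v : Fin (suc n)) → v ≢ 0F → suc (zero {n}) Fin.< punchIn 1F v
1<punchIn1 zero    v≢0 = contradiction refl v≢0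
1<punchIn1 (suc v) _   = s<s z<s

punchIn1<1⇒≡0 : (v : Fin (suc n)) → punchIn 1F v Fin.< suc (zero {n}) → v ≡ 0F
punchIn1<1⇒≡0 zero    _         = refl
punchIn1<1⇒≡0 (suc v) (s<s ())

module Insertion (σ : Permutation′ (suc m)) (p : Fin (2+ m)) where

  τ : Permutation′ (2+ m)
  τ = insert p 1F σ

  τ-at : τ ⟨$⟩ʳ p ≡ 1F
  τ-at = insert-at p 1F σ

  τ-punchIn : ∀ i → τ ⟨$⟩ʳ punchIn p i ≡ punchIn 1F (σ ⟨$⟩ʳ i)
  τ-punchIn = insert-punchIn p 1F σ

  old<old : ∀ {i j} → σ ⟨$⟩ʳ i Fin.< σ ⟨$⟩ʳ j → τ ⟨$⟩ʳ punchIn p i Fin.< τ ⟨$⟩ʳ punchIn p j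
  old<old = subst₂ Fin._<_ (sym (τ-punchIn _)) (sym (τ-punchIn _)) ∘ punchIn-mono-< 1F

  old<old⁻¹ : ∀ {i j} → τ ⟨$⟩ʳ punchIn p i Fin.< τ ⟨$⟩ʳ punchIn p j → σ ⟨$⟩ʳ i Fin.< σ ⟨$⟩ʳ j
  old<old⁻¹ = punchIn-cancel-< 1F ∘ subst₂ Fin._<_ (τ-punchIn _) (τ-punchIn _)

  new<old : ∀ {i} → σ ⟨$⟩ʳ i ≢ 0F → τ ⟨$⟩ʳ p Fin.< τ ⟨$⟩ʳ punchIn p i
  new<old = subst₂ Fin._<_ (sym τ-at) (sym (τ-punchIn _)) ∘ 1<punchIn1 (σ ⟨$⟩ʳ _)

  old<new⁻¹ : ∀ {i} → τ ⟨$⟩ʳ punchIn p i Fin.< τ ⟨$⟩ʳ p → σ ⟨$⟩ʳ i ≡ 0F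
  old<new⁻¹ = punchIn1<1⇒≡0 (σ ⟨$⟩ʳ _) ∘ subst₂ Fin._<_ (τ-punchIn _) τ-at

  -- An inserted 2 can spoil only the letter 1, and 1 is an LR-maximum only in first position. So
  -- the one exception is a 2 put in front of a word starting with 1, ruled out by `exclude`.
  LRMax-old : ∀ i → (p ≡ 0F → i ≡ 0F → σ ⟨$⟩ʳ i ≢ 0F) →
              LRMax (τ ⟨$⟩ʳ_) (punchIn p i) ⇔ LRMax (σ ⟨$⟩ʳ_) i
  LRMax-old i exclude = mk⇔
    (λ max j j<i → old<old⁻¹ (max (punchIn p j) (punchIn-mono-< p j<i)))
    (λ max → punchIn-elim (λ j → j Fin.< punchIn p i → τ ⟨$⟩ʳ j Fin.< τ ⟨$⟩ʳ punchIn p i) p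
      (λ p<i → new<old (nonzero p i exclude p<i max))
      (λ j j<i → old<old (max j (punchIn-cancel-< p j<i))))
    where
    nonzero : ∀ p i → (p ≡ 0F → i ≡ 0F → σ ⟨$⟩ʳ i ≢ 0F) →
              p Fin.< punchIn p i → LRMax (σ ⟨$⟩ʳ_) i → σ ⟨$⟩ʳ i ≢ 0F
    nonzero zero    zero    exclude _ _ = exclude refl refl
    -- An LR-maximum after the first position exceeds the first letter, so it is not 1.
    nonzero p       (suc i) _ _ max σi≡0 with () ← subst (σ ⟨$⟩ʳ 0F Fin.<_) σi≡0 (max 0F z<s)

  -- Only 1 is smaller than 2. Applied contrapositively: a letter other than 1 to the left of 2
  -- keeps it from being an LR-maximum.
  LRMax-new : LRMax (τ ⟨$⟩ʳ_) p → ∀ i → punchIn p i Fin.< p → σ ⟨$⟩ʳ i ≡ 0F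
  LRMax-new max i i<p = old<new⁻¹ (max (punchIn p i) i<p)

  count-LRMax : (p ≡ 0F → σ ⟨$⟩ʳ 0F ≢ 0F) →
    count (LRMax? (τ ⟨$⟩ʳ_)) ≡ 𝟙 (LRMax? (τ ⟨$⟩ʳ_) p) + count (LRMax? (σ ⟨$⟩ʳ_))
  count-LRMax exclude = trans (count-remove (LRMax? (τ ⟨$⟩ʳ_)) p)
    (cong (𝟙 (LRMax? (τ ⟨$⟩ʳ_) p) +_)
      (count-cong (LRMax? (τ ⟨$⟩ʳ_) ∘ punchIn p) (LRMax? (σ ⟨$⟩ʳ_))
        (λ i → LRMax-old i λ { p≡0 refl → exclude p≡0 })))

  -- An old letter to the left of 1 is not 1 itself, so it exceeds 2 wherever 2 is inserted.
  RLMaxBefore-old : ∀ q → σ ⟨$⟩ʳ q ≡ 0F → ∀ i →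
    RLMaxBefore (punchIn p q) (τ ⟨$⟩ʳ_) (punchIn p i) ⇔ RLMaxBefore q (σ ⟨$⟩ʳ_) i
  RLMaxBefore-old q σq≡0 i = mk⇔
    (λ { (i<q , max) → punchIn-cancel-< p i<q , λ j i<j j<q →
         old<old⁻¹ (max (punchIn p j) (punchIn-mono-< p i<j) (punchIn-mono-< p j<q)) })
    (λ { (i<q , max) → punchIn-mono-< p i<q ,
         punchIn-elim (λ j → punchIn p i Fin.< j → j Fin.< punchIn p q →
                             τ ⟨$⟩ʳ j Fin.< τ ⟨$⟩ʳ punchIn p i) p
           (λ _ _ → new<old λ σi≡0 →
             Fin.<⇒≢ i<q (⟨$⟩ʳ-injective σ (trans σi≡0 (sym σq≡0))))
           (λ j i<j j<q → old<old (max j (punchIn-cancel-< p i<j) (punchIn-cancel-< p j<q))) })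

  RLMaxBefore-new : ∀ q → σ ⟨$⟩ʳ q ≡ 0F →
    RLMaxBefore (punchIn p q) (τ ⟨$⟩ʳ_) p ⇔ p ≡ inject₁ q
  RLMaxBefore-new q σq≡0 = mk⇔ only-before-q at-q
    where
    only-before-q : RLMaxBefore (punchIn p q) (τ ⟨$⟩ʳ_) p → p ≡ inject₁ q
    only-before-q (p<q′ , max) with p Fin.≟ inject₁ q
    ... | yes p≡q = p≡q
    -- With 2 further left, `inject₁ q` is the position just before 1 in `τ`. Its letter lies
    -- between 2 and 1 and is not smaller than 2.
    ... | no p≢q = contradiction (max (inject₁ q) p<q q<q′) (ℕ.≤⇒≯ new≤)
      where
      p≤q : p Fin.≤ q
      p≤q = <punchIn⇒≤ p q p<q′

      p<q : p Fin.< inject₁ q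
      p<q = Fin.≤∧≢⇒< (subst (toℕ p ≤_) (sym (Fin.toℕ-inject₁ q)) p≤q) p≢q

      q<q′ : inject₁ q Fin.< punchIn p q
      q<q′ = subst₂ _<_ (sym (Fin.toℕ-inject₁ q)) (sym (toℕ-punchIn-≥ p q p≤q)) (ℕ.n<1+n _)

      -- A letter below 2 would be 1, which stands at `punchIn p q` instead.
      new≤ : τ ⟨$⟩ʳ p Fin.≤ τ ⟨$⟩ʳ inject₁ q
      new≤ = ℕ.≮⇒≥ λ lt → Fin.<⇒≢ q<q′ (⟨$⟩ʳ-injective τ (trans
        (only-0 (subst (τ ⟨$⟩ʳ inject₁ q Fin.<_) τ-at lt))
        (sym (trans (τ-punchIn q) (cong (punchIn 1F) σq≡0)))))
        where
        only-0 : ∀ {v : Fin (2+ m)} → v Fin.< suc (zero {m}) → v ≡ 0F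
        only-0 {zero}  _        = refl
        only-0 {suc v} (s<s ())

    at-q : p ≡ inject₁ q → RLMaxBefore (punchIn p q) (τ ⟨$⟩ʳ_) p
    -- The letter 1 now follows 2 directly, leaving no position between them to check.
    at-q p≡q = subst (toℕ p <_) (sym q′≡1+p) (ℕ.n<1+n _) ,
      λ j p<j j<q′ → contradiction (subst (toℕ j <_) q′≡1+p j<q′) (ℕ.≤⇒≯ p<j)
      where
      toℕ-p : toℕ p ≡ toℕ q
      toℕ-p = trans (cong toℕ p≡q) (Fin.toℕ-inject₁ q)

      q′≡1+p : toℕ (punchIn p q) ≡ suc (toℕ p)
      q′≡1+p = trans (toℕ-punchIn-≥ p q (ℕ.≤-reflexive toℕ-p)) (cong suc (sym toℕ-p))

place-0 : ∀ (q : Fin (suc m)) c → (place q ⟨$⟩ʳ c ≡ inject₁ q) ⇔ (c ≡ 0F)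
place-0 q zero    = mk⇔ (λ _ → refl) (λ _ → refl)
place-0 q (suc c) = mk⇔ (λ eq → contradiction eq (Fin.punchInᵢ≢i (inject₁ q) c)) (λ ())

rlm-insert2 : (σ : Permutation′ (suc m)) (c : Fin (2+ m)) →
              rlm (insert2 σ c) ≡ 𝟙 (c Fin.≟ 0F) + rlm σ
rlm-insert2 σ c = begin
  rlm τ
    ≡⟨ rlm-count τ (punchIn p q) (trans (τ-punchIn q) (cong (punchIn 1F) σq≡0)) ⟩
  count R?
    ≡⟨ count-remove R? p ⟩
  𝟙 (R? p) + count (R? ∘ punchIn p)
    ≡⟨ cong₂ _+_
         (𝟙-cong (mk⇔ (to (place-0 q c) ∘ to new) (from new ∘ from (place-0 q c))) (R? p) (c Fin.≟ 0F))
         (count-cong (R? ∘ punchIn p) (RLMaxBefore? q (σ ⟨$⟩ʳ_)) (RLMaxBefore-old q σq≡0)) ⟩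
  𝟙 (c Fin.≟ 0F) + count (RLMaxBefore? q (σ ⟨$⟩ʳ_))
    ≡⟨ cong (𝟙 (c Fin.≟ 0F) +_) (rlm-count σ q σq≡0) ⟨
  𝟙 (c Fin.≟ 0F) + rlm σ ∎
  where
  q = position1 σ
  σq≡0 = inverseʳ σ
  p = place q ⟨$⟩ʳ c
  open Insertion σ p
  R? = RLMaxBefore? (punchIn p q) (τ ⟨$⟩ʳ_)
  new = RLMaxBefore-new q σq≡0

-- With `q` a variable, matching on it and on `c` makes `place q` compute: `q` tells whether the
-- word starts with 1, and `place q` sends `1F` to `1F` if it does and to `0F` otherwise. For `c`
-- other than `1F`, unless 2 goes in front of an initial 1, some letter other than 1 precedes it.
count-LRMax-insert : (σ : Permutation′ (suc m)) (q : Fin (suc m)) → σ ⟨$⟩ʳ q ≡ 0F → ∀ c →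
  count (LRMax? (insert (place q ⟨$⟩ʳ c) 1F σ ⟨$⟩ʳ_)) ≡ 𝟙 (c Fin.≟ 1F) + count (LRMax? (σ ⟨$⟩ʳ_))
-- The word 1⋯ becomes 21⋯: the new LR-maximum 2 replaces the lost one, 1.
count-LRMax-insert σ zero σ0≡0 zero = cong₂ _+_
  (trans (𝟙-true (LRMax? (τ ⟨$⟩ʳ_) 0F) (λ _ ())) (sym (𝟙-true (LRMax? (σ ⟨$⟩ʳ_) 0F) (λ _ ()))))
  (cong₂ _+_
    (𝟙-false (LRMax? (τ ⟨$⟩ʳ_) 1F) λ max →
      contradiction (subst₂ Fin._<_ τ-at (trans (τ-punchIn 0F) (cong (punchIn 1F) σ0≡0)) (max 0F z<s)) λ ())
    (count-cong (λ i → LRMax? (τ ⟨$⟩ʳ_) (suc (suc i))) (λ i → LRMax? (σ ⟨$⟩ʳ_) (suc i))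
      (λ i → LRMax-old (suc i) (λ _ ()))))
  where open Insertion σ 0F
count-LRMax-insert σ zero σ0≡0 1F = trans (count-LRMax (λ ()))
  (cong (_+ count (LRMax? (σ ⟨$⟩ʳ_))) (𝟙-true (LRMax? (τ ⟨$⟩ʳ_) 1F)
    λ { zero _ → subst₂ Fin._<_ (sym (trans (τ-punchIn 0F) (cong (punchIn 1F) σ0≡0))) (sym τ-at) z<s
      ; (suc _) (s<s ()) }))
  where open Insertion σ 1F
-- The word starts with 1, so its second letter is the one that blocks 2.
count-LRMax-insert {suc m} σ zero σ0≡0 (suc (suc c)) = trans (count-LRMax (λ ()))
  (cong (_+ count (LRMax? (σ ⟨$⟩ʳ_))) (𝟙-false (LRMax? (τ ⟨$⟩ʳ_) p) λ max →
    contradiction (⟨$⟩ʳ-injective σ (trans (LRMax-new max 1F (s<s z<s)) (sym σ0≡0))) λ ()))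
  where
  p = suc (suc c)
  open Insertion σ p
-- The first letter is not 1 and stays to the left of 2.
count-LRMax-insert σ (suc q) σq≡0 zero = trans (count-LRMax (λ ()))
  (cong (_+ count (LRMax? (σ ⟨$⟩ʳ_))) (𝟙-false (LRMax? (τ ⟨$⟩ʳ_) p) λ max →
    contradiction (⟨$⟩ʳ-injective σ (trans (LRMax-new max 0F z<s) (sym σq≡0))) λ ()))
  where
  p = suc (inject₁ q)
  open Insertion σ p
count-LRMax-insert σ (suc q) σq≡0 1F = trans
  (count-LRMax λ _ σ0≡0 → contradiction (⟨$⟩ʳ-injective σ (trans σ0≡0 (sym σq≡0))) λ ())
  (cong (_+ count (LRMax? (σ ⟨$⟩ʳ_))) (𝟙-true (LRMax? (τ ⟨$⟩ʳ_) 0F) (λ _ ())))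
  where open Insertion σ 0F
count-LRMax-insert σ (suc q) σq≡0 (suc (suc c)) = trans (count-LRMax (λ ()))
  (cong (_+ count (LRMax? (σ ⟨$⟩ʳ_))) (𝟙-false (LRMax? (τ ⟨$⟩ʳ_) p) λ max →
    contradiction (⟨$⟩ʳ-injective σ (trans (LRMax-new max 0F z<s) (sym σq≡0))) λ ()))
  where
  p = suc (punchIn (inject₁ q) c)
  open Insertion σ p

lrmax-insert2 : (σ : Permutation′ (suc m)) (c : Fin (2+ m)) →
                lrmax (word (insert2 σ c)) ≡ 𝟙 (c Fin.≟ 1F) + lrmax (word σ)
lrmax-insert2 σ c = begin
  lrmax (word (insert2 σ c))
    ≡⟨ lrmax-letters (insert2 σ c ⟨$⟩ʳ_) ⟩
  count (LRMax? (insert2 σ c ⟨$⟩ʳ_))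
    ≡⟨ count-LRMax-insert σ (position1 σ) (inverseʳ σ) c ⟩
  𝟙 (c Fin.≟ 1F) + count (LRMax? (σ ⟨$⟩ʳ_))
    ≡⟨ cong (𝟙 (c Fin.≟ 1F) +_) (lrmax-letters (σ ⟨$⟩ʳ_)) ⟨
  𝟙 (c Fin.≟ 1F) + lrmax (word σ) ∎

-- The involution and the exchange of the statistics.

exchange01 : Fin (2+ m) → Fin (2+ m)
exchange01 0F            = 1F
exchange01 1F            = 0F
exchange01 (suc (suc c)) = suc (suc c)

exchange01-involutive : Involutive _≡_ (exchange01 {m})
exchange01-involutive 0F            = refl
exchange01-involutive 1F            = refl
exchange01-involutive (suc (suc c)) = refl

exchange01-𝟙 : (c : Fin (2+ m)) → 𝟙 (exchange01 c Fin.≟ 1F) ≡ 𝟙 (c Fin.≟ 0F)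
exchange01-𝟙 0F            = refl
exchange01-𝟙 1F            = refl
exchange01-𝟙 (suc (suc c)) = refl

φ : Permutation′ (suc m) → Permutation′ (suc m)
φ {zero}  π = π
φ {suc m} π = insert2 (φ (delete2 π)) (exchange01 (code2 π))

φ-cong : Congruent _≈_ _≈_ (φ {m})
φ-cong {zero}          π≈ρ = π≈ρ
φ-cong {suc m} {π} {ρ} π≈ρ = insert2-cong (φ (delete2 π)) (φ (delete2 ρ))
  (φ-cong {x = delete2 π} {delete2 ρ} (delete2-cong π ρ π≈ρ))
  (cong exchange01 (code2-cong π ρ π≈ρ))

-- Deleting 2 from `φ π` and reading its code recover the two data from which `φ π` was built, so a
-- second application exchanges the code back and recurses on the shorter permutation.
φ-involutive : Involutive _≈_ (φ {m})
φ-involutive {zero}  π k = refl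
φ-involutive {suc m} π k = begin
  φ (φ π) ⟨$⟩ʳ k
    ≡⟨ insert2-cong (φ (delete2 (φ π))) (φ (φ (delete2 π)))
         (φ-cong {x = delete2 (φ π)} {φ (delete2 π)} (delete2-insert2 (φ (delete2 π)) (exchange01 (code2 π))))
         (cong exchange01 (code2-insert2 (φ (delete2 π)) (exchange01 (code2 π)))) k ⟩
  insert2 (φ (φ (delete2 π))) (exchange01 (exchange01 (code2 π))) ⟨$⟩ʳ k
    ≡⟨ insert2-cong (φ (φ (delete2 π))) (delete2 π)
         (φ-involutive (delete2 π)) (exchange01-involutive (code2 π)) k ⟩
  insert2 (delete2 π) (code2 π) ⟨$⟩ʳ k
    ≡⟨ insert2-delete2 π k ⟩
  π ⟨$⟩ʳ k ∎

rlm-cong : (π ρ : Permutation′ n) → π ≈ ρ → rlm π ≡ rlm ρ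
rlm-cong π ρ π≈ρ = cong (rlmax ∘ leftOf1) (word-cong π ρ π≈ρ)

-- Code 0 raises `rlm` and code 1 raises `lrmax`, so the exchanged code contributes equally to both
-- sides. Writing `suc` on the right avoids truncated subtraction in the induction.
lrmax-φ : (π : Permutation′ (suc m)) → lrmax (word (φ π)) ≡ suc (rlm π)
lrmax-φ {zero} π with π ⟨$⟩ʳ 0F
... | 0F = refl
lrmax-φ {suc m} π = begin
  lrmax (word (insert2 (φ σ) (exchange01 c)))          ≡⟨ lrmax-insert2 (φ σ) (exchange01 c) ⟩
  𝟙 (exchange01 c Fin.≟ 1F) + lrmax (word (φ σ))       ≡⟨ cong₂ _+_ (exchange01-𝟙 c) (lrmax-φ σ) ⟩
  𝟙 (c Fin.≟ 0F) + suc (rlm σ)                         ≡⟨ ℕ.+-suc _ _ ⟩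
  suc (𝟙 (c Fin.≟ 0F) + rlm σ)                         ≡⟨ cong suc (rlm-insert2 σ c) ⟨
  suc (rlm (insert2 σ c))                              ≡⟨ cong suc (rlm-cong (insert2 σ c) π (insert2-delete2 π)) ⟩
  suc (rlm π) ∎
  where
  σ = delete2 π
  c = code2 π

theorem3p1 : (n : ℕ) → n ≥ 1 →
    Σ[ φ ∈ (Permutation′ n → Permutation′ n) ]
    ( Congruent _≈_ _≈_ φ
    × Involutive _≈_ φ
    × ((π : Permutation′ n) →
    (rlm π ≡ lrmax (word (φ π)) ∸ 1) ×
    (lrmax (word π) ∸ 1 ≡ rlm (φ π))) )
theorem3p1 (suc m) _ =
  φ , (λ {π} {ρ} → φ-cong {x = π} {ρ}) , φ-involutive , λ π →
    cong (_∸ 1) (sym (lrmax-φ π)) ,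
    -- The second equality is the first one for `φ π`, since `φ (φ π) ≈ π`.
    cong (_∸ 1) (begin
      lrmax (word π)          ≡⟨ cong lrmax (word-cong (φ (φ π)) π (φ-involutive π)) ⟨
      lrmax (word (φ (φ π)))  ≡⟨ lrmax-φ (φ π) ⟩
      suc (rlm (φ π))         ∎)
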